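{- Let $\Sigma=(G,\sigma)$ be a signed graph (with $G$ simple, finite and connected) with diameter greater than $n$, and suppose the $n^{th}$ power of $\Sigma$ is unique. If $\Sigma^n=(G^n,\sigma')$ is compatible, then $\Sigma$ is compatible.
   Context: A signed graph $\Sigma=(G,\sigma)$ consists of a graph $G=(V,E)$ and a signature $\sigma:E\to\{1,-1\}$. The sign of a path is the product of the signs of its edges. For vertices $u,v$, $d(u,v)$ is the distance in $G$, and $\mathcal{P}_{(u,v)}$ is the set of shortest $u$–$v$ paths; $\sigma_{\max}(u,v)=\max\{\sigma(P):P\in\mathcal{P}_{(u,v)}\}$, $\sigma_{\min}(u,v)=\min\{\sigma(P):P\in\mathcal{P}_{(u,v)}\}$, $d_{\max}(u,v)=\sigma_{\max}(u,v)d(u,v)$, $d_{\min}(u,v)=\sigma_{\min}(u,v)d(u,v)$. Vertices $u,v$ are compatible if $d_{\max}(u,v)=d_{\min}(u,v)$; a signed graph is compatible if every pair of its vertices is compatible (these notions apply to any signed graph, in particular to $\Sigma^n$, using its own distances and path signs). The $n^{th}$ power $G^n$ has vertex set $V$, with $u\ne v$ adjacent iff $d(u,v)\le n$. $\Sigma_{\max}^n=(G^n,\sigma')$ with $\sigma'(uv)=\sigma_{\max}(u,v)$ and $\Sigma_{\min}^n=(G^n,\sigma'')$ with $\sigma''(uv)=\sigma_{\min}(u,v)$. The $n^{th}$ power is unique if $\Sigma_{\max}^n=\Sigma_{\min}^n$, and this common signed graph is denoted $\Sigma^n$. -}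

module Defs where

open import Data.Nat using (ℕ; zero; suc; _≤_; _<_)
open import Data.Fin using (Fin)
open import Data.Bool using (Bool; true)
open import Data.Sign using (Sign) renaming (_*_ to _*ˢ_)
open import Data.Integer using (ℤ; _◃_)
open import Data.Product using (Σ; ∃; ∃-syntax; _×_; _,_)
open import Data.Sum using (_⊎_)
open import Relation.Binary.PropositionalEquality using (_≡_; _≢_)

-- Order on signs: -1 < +1.
_≤ˢ_ : Sign → Sign → Set
s ≤ˢ t = s ≡ Sign.- ⊎ t ≡ Sign.+

-- A signed graph on vertex set Fin k, given by a (signed) edge relation:
-- E u v s  means  "uv is an edge with sign s".
EdgeRel : ℕ → Set₁
EdgeRel k = Fin k → Fin k → Sign → Set

-- Walks from u to v of length l and sign s (sign = product of edge signs).
data Walk {k : ℕ} (E : EdgeRel k) : Fin k → Fin k → ℕ → Sign → Set where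
  []  : ∀ {u} → Walk E u u 0 Sign.+
  _∷_ : ∀ {u w v l s t} → E u w s → Walk E w v l t → Walk E u v (suc l) (s *ˢ t)

module _ {k : ℕ} (E : EdgeRel k) where

  -- d(u,v) = d
  IsDist : Fin k → Fin k → ℕ → Set
  IsDist u v d = (∃[ s ] Walk E u v d s) × (∀ l s → Walk E u v l s → d ≤ l)

  -- some shortest u–v path (element of P_(u,v)) has sign s
  ShortestSign : Fin k → Fin k → Sign → Set
  ShortestSign u v s = ∃[ d ] (IsDist u v d × Walk E u v d s)

  -- σ_max(u,v) = s
  IsσMax : Fin k → Fin k → Sign → Set
  IsσMax u v s = ShortestSign u v s × (∀ t → ShortestSign u v t → t ≤ˢ s)

  -- σ_min(u,v) = s
  IsσMin : Fin k → Fin k → Sign → Set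
  IsσMin u v s = ShortestSign u v s × (∀ t → ShortestSign u v t → s ≤ˢ t)

  -- u,v compatible: d_max(u,v) = d_min(u,v), where d_max = σ_max·d, d_min = σ_min·d
  CompatiblePair : Fin k → Fin k → Set
  CompatiblePair u v = ∀ d smax smin → IsDist u v d → IsσMax u v smax → IsσMin u v smin →
                       smax ◃ d ≡ smin ◃ d

  Compatible : Set
  Compatible = ∀ u v → CompatiblePair u v

  Connected : Set
  Connected = ∀ u v → ∃[ l ] ∃[ s ] Walk E u v l s

  IsDiameter : ℕ → Set
  IsDiameter D = (∃[ u ] ∃[ v ] IsDist u v D) × (∀ u v d → IsDist u v d → d ≤ D)

-- A finite simple signed graph Σ = (G, σ) on vertex set Fin k.
record SignedGraph (k : ℕ) : Set where
  field
    adj       : Fin k → Fin k → Bool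
    adj-sym   : ∀ u v → adj u v ≡ adj v u
    adj-irrefl : ∀ u → adj u u ≡ Data.Bool.false
    σ         : Fin k → Fin k → Sign        -- only values on edges matter
    σ-sym     : ∀ u v → σ u v ≡ σ v u

  Edge : EdgeRel k
  Edge u v s = adj u v ≡ true × σ u v ≡ s

open SignedGraph public

-- Σ^n_max = (G^n, σ'),  σ'(uv) = σ_max(u,v)
PowMax : ∀ {k} → SignedGraph k → ℕ → EdgeRel k
PowMax S n u v s = u ≢ v × (∃[ d ] (IsDist (Edge S) u v d × d ≤ n)) × IsσMax (Edge S) u v s

-- Σ^n_min = (G^n, σ''),  σ''(uv) = σ_min(u,v)
PowMin : ∀ {k} → SignedGraph k → ℕ → EdgeRel k
PowMin S n u v s = u ≢ v × (∃[ d ] (IsDist (Edge S) u v d × d ≤ n)) × IsσMin (Edge S) u v s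

-- The n-th power is unique: Σ^n_max = Σ^n_min (same underlying G^n, equal signatures)
PowerUnique : ∀ {k} → SignedGraph k → ℕ → Set
PowerUnique S n = ∀ u v s t → PowMax S n u v s → PowMin S n u v t → s ≡ t

-- Cut a shortest u–v walk of Σ into consecutive pieces of length n, the last one possibly
-- shorter. Each piece is a shortest path of length at most n, hence an edge of Σⁿ, and
-- uniqueness of the power forces its sign in Σⁿ to be the sign of the piece. So a shortest
-- walk of length d and sign s in Σ yields a walk of length ⌈d/n⌉ and sign s in Σⁿ, and
-- ⌈d/n⌉ is the Σⁿ-distance because an edge of Σⁿ unfolds to at most n edges of Σ. Two
-- shortest u–v paths of opposite signs in Σ therefore give two shortest paths of opposite
-- signs in Σⁿ, which compatibility of Σⁿ forbids.
module Submission where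

open import Defs
open import Data.Fin using (Fin)
open import Data.Nat using (ℕ; zero; suc; _+_; _*_; _∸_; _≤_; _<_; z≤n; s≤s; _≤?_)
open import Data.Nat.Properties
open import Data.Nat.Induction using (<-wellFounded)
open import Induction.WellFounded using (Acc; acc)
open import Data.Sign using (Sign) renaming (_*_ to _*ˢ_)
import Data.Sign.Properties as Signₚ
open import Data.Integer using (_◃_)
open import Data.Integer.Properties using (sign-cong′)
open import Data.Product using (∃-syntax; _×_; _,_; proj₁; proj₂)
open import Data.Sum using (inj₁; inj₂)
open import Relation.Nullary using (yes; no)
open import Relation.Binary.PropositionalEquality

≤ˢ-reflexive : ∀ {s t} → s ≡ t → s ≤ˢ t
≤ˢ-reflexive {Sign.-} _ = inj₁ refl
≤ˢ-reflexive {Sign.+} refl = inj₂ refl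

≤ˢ-maximum : ∀ s → s ≤ˢ Sign.+
≤ˢ-maximum _ = inj₂ refl

≤ˢ-minimum : ∀ s → Sign.- ≤ˢ s
≤ˢ-minimum _ = inj₁ refl

module _ {k : ℕ} {E : EdgeRel k} where

  infixr 5 _++_

  _++_ : ∀ {u w v a b s t} → Walk E u w a s → Walk E w v b t → Walk E u v (a + b) (s *ˢ t)
  [] ++ W = W
  _++_ {t = t} (_∷_ {s = s₁} {t = s₂} e W₁) W₂ =
    subst (Walk E _ _ _) (sym (Signₚ.*-assoc s₁ s₂ t)) (e ∷ (W₁ ++ W₂))

  splitAt : ∀ a {b u v s} → Walk E u v (a + b) s →
            ∃[ w ] ∃[ s₁ ] ∃[ s₂ ] (Walk E u w a s₁ × Walk E w v b s₂ × s ≡ s₁ *ˢ s₂)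
  splitAt zero W = _ , _ , _ , [] , W , refl
  splitAt (suc a) (_∷_ {s = s} e W) with splitAt a W
  ... | w , s₁ , s₂ , W₁ , W₂ , eq =
    w , s *ˢ s₁ , s₂ , e ∷ W₁ , W₂ , trans (cong (s *ˢ_) eq) (sym (Signₚ.*-assoc s s₁ s₂))

  IsDist-unique : ∀ {u v d d′} → IsDist E u v d → IsDist E u v d′ → d ≡ d′
  IsDist-unique ((_ , W) , d≤) ((_ , W′) , d′≤) = ≤-antisym (d≤ _ _ W′) (d′≤ _ _ W)

  IsDist-prefix : ∀ {a b u w v s₁ s₂} → IsDist E u v (a + b) →
                  Walk E u w a s₁ → Walk E w v b s₂ → IsDist E u w a
  IsDist-prefix {a} {b} (_ , d≤) W₁ W₂ =
    (_ , W₁) , λ l _ X → +-cancelʳ-≤ b a l (d≤ (l + b) _ (X ++ W₂))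

  IsDist-suffix : ∀ {a b u w v s₁ s₂} → IsDist E u v (a + b) →
                  Walk E u w a s₁ → Walk E w v b s₂ → IsDist E w v b
  IsDist-suffix {a} {b} (_ , d≤) W₁ W₂ =
    (_ , W₂) , λ l _ X → +-cancelˡ-≤ a b l (d≤ (a + l) _ (W₁ ++ X))

  shortest⁺⇒σMax⁺ : ∀ {u v d} → IsDist E u v d → Walk E u v d Sign.+ → IsσMax E u v Sign.+
  shortest⁺⇒σMax⁺ dist W = (_ , dist , W) , λ t _ → ≤ˢ-maximum t

  shortest⁻⇒σMin⁻ : ∀ {u v d} → IsDist E u v d → Walk E u v d Sign.- → IsσMin E u v Sign.-
  shortest⁻⇒σMin⁻ dist W = (_ , dist , W) , λ t _ → ≤ˢ-minimum t

  CompatiblePair⇒opposite-shortest-trivial :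
    ∀ {u v d} → CompatiblePair E u v → IsDist E u v d →
    Walk E u v d Sign.+ → Walk E u v d Sign.- → d ≡ 0
  CompatiblePair⇒opposite-shortest-trivial compat dist W⁺ W⁻
    with sign-cong′ (compat _ _ _ dist (shortest⁺⇒σMax⁺ dist W⁺) (shortest⁻⇒σMin⁻ dist W⁻))
  ... | inj₁ ()
  ... | inj₂ (d≡0 , _) = d≡0

  opposite-shortest-trivial⇒Compatible :
    (∀ u v d → IsDist E u v d → Walk E u v d Sign.+ → Walk E u v d Sign.- → d ≡ 0) →
    Compatible E
  opposite-shortest-trivial⇒Compatible _ _ _ _ Sign.+ Sign.+ _ _ _ = refl
  opposite-shortest-trivial⇒Compatible _ _ _ _ Sign.- Sign.- _ _ _ = refl
  opposite-shortest-trivial⇒Compatible _ _ _ _ Sign.- Sign.+ _ (_ , max) (min , _)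
    with max Sign.+ min
  ... | inj₁ ()
  ... | inj₂ ()
  opposite-shortest-trivial⇒Compatible trivial u v d Sign.+ Sign.- dist
    ((_ , dist⁺ , W⁺) , _) ((_ , dist⁻ , W⁻) , _)
    with IsDist-unique dist⁺ dist | IsDist-unique dist⁻ dist
  ... | refl | refl with trivial u v d dist W⁺ W⁻
  ... | refl = refl

IsCeilDiv : ℕ → ℕ → ℕ → Set
IsCeilDiv d n c = d ≤ c * n × (∀ l → d ≤ l * n → c ≤ l)

IsCeilDiv-unique : ∀ {d n c c′} → IsCeilDiv d n c → IsCeilDiv d n c′ → c ≡ c′
IsCeilDiv-unique (d≤cn , c-least) (d≤c′n , c′-least) = ≤-antisym (c-least _ d≤c′n) (c′-least _ d≤cn)

IsCeilDiv-zero : ∀ n → IsCeilDiv 0 n 0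
IsCeilDiv-zero n = z≤n , λ _ _ → z≤n

IsCeilDiv-one : ∀ {d n} → 1 ≤ d → d ≤ n → IsCeilDiv d n 1
IsCeilDiv-one {d} {n} 1≤d d≤n = subst (d ≤_) (sym (+-identityʳ n)) d≤n , least
  where
  least : ∀ l → d ≤ l * n → 1 ≤ l
  least zero d≤0 = ≤-trans 1≤d d≤0
  least (suc l) _ = s≤s z≤n

IsCeilDiv-suc : ∀ {r n c} → 1 ≤ n → IsCeilDiv r n c → IsCeilDiv (n + r) n (suc c)
IsCeilDiv-suc {r} {n} {c} 1≤n (r≤cn , c-least) = +-monoʳ-≤ n r≤cn , least
  where
  least : ∀ l → n + r ≤ l * n → suc c ≤ l
  least zero n+r≤0 with ≤-trans 1≤n (≤-trans (m≤m+n n r) n+r≤0)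
  ... | ()
  least (suc l) n+r≤n+ln = s≤s (c-least l (+-cancelˡ-≤ n r (l * n) n+r≤n+ln))

module PowerWalk {k : ℕ} (S : SignedGraph k) (n : ℕ) (1≤n : 1 ≤ n) (unique : PowerUnique S n) where

  private
    E = Edge S
    Σⁿ = PowMax S n

  ShortestSign-unique : ∀ {u v d s t} → u ≢ v → IsDist E u v d → d ≤ n →
                        ShortestSign E u v s → ShortestSign E u v t → s ≡ t
  ShortestSign-unique {s = Sign.+} {Sign.+} _ _ _ _ _ = refl
  ShortestSign-unique {s = Sign.-} {Sign.-} _ _ _ _ _ = refl
  ShortestSign-unique {s = Sign.+} {Sign.-} u≢v dist d≤n sp⁺ sp⁻ =
    unique _ _ _ _ (u≢v , (_ , dist , d≤n) , sp⁺ , λ t _ → ≤ˢ-maximum t)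
                   (u≢v , (_ , dist , d≤n) , sp⁻ , λ t _ → ≤ˢ-minimum t)
  ShortestSign-unique {s = Sign.-} {Sign.+} u≢v dist d≤n sp⁻ sp⁺ =
    sym (ShortestSign-unique u≢v dist d≤n sp⁺ sp⁻)

  shortest⇒power-edge : ∀ {u v d s} → IsDist E u v d → 1 ≤ d → d ≤ n → Walk E u v d s → Σⁿ u v s
  shortest⇒power-edge {u} {v} {d} {s} dist 1≤d d≤n W =
    u≢v , (d , dist , d≤n) , sp , λ t spₜ → ≤ˢ-reflexive (ShortestSign-unique u≢v dist d≤n spₜ sp)
    where
    sp : ShortestSign E u v s
    sp = d , dist , W
    u≢v : u ≢ v
    u≢v refl with ≤-trans 1≤d (proj₂ dist 0 _ [])
    ... | ()

  ChunkedWalk : Fin k → Fin k → ℕ → Sign → Set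
  ChunkedWalk u v d s = ∃[ c ] (Walk Σⁿ u v c s × IsCeilDiv d n c)

  power-edge⇒walk : ∀ {u v s} → Σⁿ u v s → Walk Σⁿ u v 1 s
  power-edge⇒walk {s = s} e = subst (Walk Σⁿ _ _ 1) (Signₚ.*-identityʳ s) (e ∷ [])

  shortest⇒power-walk : ∀ {u v d s} → Acc _<_ d → IsDist E u v d → Walk E u v d s →
                        ChunkedWalk u v d s
  shortest⇒power-walk {d = zero} _ _ [] = 0 , [] , IsCeilDiv-zero n
  shortest⇒power-walk {u} {v} {suc d} {s} (acc rec) dist W with suc d ≤? n
  ... | yes d≤n =
    1 , power-edge⇒walk (shortest⇒power-edge dist (s≤s z≤n) d≤n W) , IsCeilDiv-one (s≤s z≤n) d≤n
  ... | no d≰n = subst (λ d′ → ChunkedWalk u v d′ s) n+r≡d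
                   (split-first-piece (subst (IsDist E u v) (sym n+r≡d) dist)
                                      (subst (λ d′ → Walk E u v d′ s) (sym n+r≡d) W))
    where
    r = suc d ∸ n
    n+r≡d : n + r ≡ suc d
    n+r≡d = m+[n∸m]≡n (<⇒≤ (≰⇒> d≰n))
    r<d : r < suc d
    r<d = subst (r <_) n+r≡d (m<n+m r 1≤n)
    split-first-piece : IsDist E u v (n + r) → Walk E u v (n + r) s →
                        ChunkedWalk u v (n + r) s
    split-first-piece dist′ W′ with splitAt n W′
    ... | _ , _ , _ , W₁ , W₂ , s≡ with shortest⇒power-walk (rec r<d) (IsDist-suffix dist′ W₁ W₂) W₂
    ... | c , Wⁿ , ceil =
      suc c ,
      subst (Walk Σⁿ u v (suc c)) (sym s≡)
            (shortest⇒power-edge (IsDist-prefix dist′ W₁ W₂) 1≤n ≤-refl W₁ ∷ Wⁿ) ,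
      IsCeilDiv-suc 1≤n ceil

  power-walk⇒walk : ∀ {u v l s} → Walk Σⁿ u v l s → ∃[ L ] ∃[ t ] (Walk E u v L t × L ≤ l * n)
  power-walk⇒walk [] = 0 , _ , [] , z≤n
  power-walk⇒walk ((_ , (d , ((_ , W) , _) , d≤n) , _) ∷ Wⁿ) with power-walk⇒walk Wⁿ
  ... | L , _ , W′ , L≤ = d + L , _ , W ++ W′ , +-mono-≤ d≤n L≤

  power-walk-IsDist : ∀ {u v d c s} → IsDist E u v d → Walk Σⁿ u v c s → IsCeilDiv d n c →
                      IsDist Σⁿ u v c
  power-walk-IsDist (_ , d≤) Wⁿ (_ , c-least) = (_ , Wⁿ) , λ l _ X → lower-bound X
    where
    lower-bound : ∀ {l t} → Walk Σⁿ _ _ l t → _ ≤ l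
    lower-bound X with power-walk⇒walk X
    ... | L , _ , W , L≤ln = c-least _ (≤-trans (d≤ L _ W) L≤ln)

  Compatible-power⇒opposite-shortest-trivial :
    Compatible Σⁿ → ∀ u v d → IsDist E u v d → Walk E u v d Sign.+ → Walk E u v d Sign.- → d ≡ 0
  Compatible-power⇒opposite-shortest-trivial compat u v d dist W⁺ W⁻
    with shortest⇒power-walk (<-wellFounded d) dist W⁺ | shortest⇒power-walk (<-wellFounded d) dist W⁻
  ... | c , Wⁿ⁺ , ceil | c′ , Wⁿ⁻ , ceil′ with IsCeilDiv-unique ceil ceil′
  ... | refl with CompatiblePair⇒opposite-shortest-trivial (compat u v)
                    (power-walk-IsDist dist Wⁿ⁺ ceil) Wⁿ⁺ Wⁿ⁻
  ... | refl = n≤0⇒n≡0 (proj₁ ceil)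

theorem2p7 : ∀ {k : ℕ} (S : SignedGraph k) (n : ℕ) → 1 ≤ n →
    Connected (Edge S) →
    (∃[ D ] (IsDiameter (Edge S) D × n < D)) →
    PowerUnique S n →
    Compatible (PowMax S n) →
    Compatible (Edge S)
theorem2p7 S n 1≤n _ _ unique compat =
  opposite-shortest-trivial⇒Compatible (Compatible-power⇒opposite-shortest-trivial compat)
  where open PowerWalk S n 1≤n unique
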